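{- Let $\ell \geq 3$ be an integer. Every Steiner triple system of order $v$ with \[ v \geq \frac{(\ell-1)(\ell^5 - 9\ell^3 + 20\ell^2 - 36\ell + 16)}{16} \] has an $\ell$-good sequencing.
   Context: A Steiner triple system of order $v$ (an STS$(v)$) is a pair $(X,\mathcal{B})$ where $X$ is a set of $v$ points and $\mathcal{B}$ is a set of 3-subsets of $X$ (blocks) such that every pair of distinct points lies in exactly one block. For an integer $\ell \geq 3$, an $\ell$-good sequencing of $(X,\mathcal{B})$ is a permutation $[x_1\, x_2\, \cdots\, x_v]$ of $X$ such that no $\ell$ consecutive points $x_j, x_{j+1},\dots,x_{j+\ell-1}$ of the permutation contain a block of $\mathcal{B}$. -}

module Defs where

open import Data.Nat using (ℕ; _+_; _≤_; _<_)
open import Data.Fin using (Fin; toℕ)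
open import Data.Product using (_×_; _,_; ∃; Σ)
open import Data.List using (List)
open import Data.List.Membership.Propositional using (_∈_)
open import Data.List.Relation.Unary.Unique.Propositional using (Unique)
open import Relation.Binary.PropositionalEquality using (_≡_)
open import Relation.Nullary using (¬_)
open import Function.Bundles using (_↔_; Inverse)

-- A block is a 3-subset of Fin v, represented canonically as a strictly
-- increasing triple (a , b , c) with a < b < c.
Triple : ℕ → Set
Triple v = Fin v × Fin v × Fin v

IsBlock : {v : ℕ} → Triple v → Set
IsBlock (a , b , c) = toℕ a < toℕ b × toℕ b < toℕ c

_∈ᵇ_ : {v : ℕ} → Fin v → Triple v → Set
x ∈ᵇ (a , b , c) = (x ≡ a) ⊎' ((x ≡ b) ⊎' (x ≡ c))
  where
  open import Data.Sum using () renaming (_⊎_ to _⊎'_)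

record STS (v : ℕ) : Set where
  field
    blocks     : List (Triple v)
    blocks-3   : ∀ {t} → t ∈ blocks → IsBlock t
    distinct   : Unique blocks
    pair-cover : ∀ (x y : Fin v) → ¬ (x ≡ y) →
                 Σ (Triple v) λ t → (t ∈ blocks × x ∈ᵇ t × y ∈ᵇ t) ×
                   (∀ t' → t' ∈ blocks → x ∈ᵇ t' → y ∈ᵇ t' → t' ≡ t)
open STS public

-- A sequencing is a permutation of the points: position i ↦ point x_i.
-- A window of ℓ consecutive positions starting at position j (with
-- j + ℓ ≤ v) is the set of positions i with j ≤ i < j + ℓ.
InWindow : {v : ℕ} → ℕ → ℕ → Fin v → Set
InWindow ℓ j i = j ≤ toℕ i × toℕ i < j + ℓ

WindowContains : {v : ℕ} → (ℓ : ℕ) → (Fin v ↔ Fin v) → ℕ → Triple v → Set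
WindowContains {v} ℓ σ j t =
  ∀ (x : Fin v) → x ∈ᵇ t → ∃ λ (i : Fin v) → InWindow ℓ j i × Inverse.to σ i ≡ x

GoodSequencing : {v : ℕ} → ℕ → STS v → (Fin v ↔ Fin v) → Set
GoodSequencing {v} ℓ S σ =
  ∀ (j : ℕ) → j + ℓ ≤ v → ∀ t → t ∈ blocks S → ¬ WindowContains ℓ σ j t

{-# OPTIONS --safe #-}

-- Put n = ℓ − 1 and M = n(n−1)/2.  Filling positions from left to right, a point is forbidden at the next
-- position only if it completes a block with two of the n preceding points, so the greedy choice gets stuck
-- only when at most M points are left.  To dispose of these, the M positions 0, ℓ, 2ℓ, …, (M−1)ℓ are left
-- blank; they are too far apart for two of them to share a window.  A point fits into a blank unless it
-- completes a block with two nearby points among the first Mℓ positions, and there are at most M·n·(n−1)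
-- such dangerous points: a position placed before the next blank has at most n−1 occupied positions among
-- the preceding n.  All dangerous points are therefore placed right after position Mℓ, each preceded by
-- n−1 fillers that make it admissible.  The greedy choice then continues up to position v, and the M
-- remaining points, none of them dangerous, go into the blanks in any order.  This needs
-- Mℓ + M·n²·(n−1) + ℓ ≤ v, which the hypothesis guarantees.
module Submission where

open import Defs
open import Data.Nat using (ℕ; _≥_)
open import Data.Integer using (ℤ; +_; _+_; _-_; _*_; _^_; _≤_)
open import Data.Product using (∃)
open import Data.Fin using (Fin)
open import Function.Bundles using (_↔_)

open import Data.Nat using (zero; suc; _<_; z≤n; s≤s; s≤s⁻¹; _∸_) renaming (_+_ to _+ℕ_; _*_ to _*ℕ_; _≤_ to _≤ℕ_)
open import Data.Nat.Properties
  using (≤-refl; ≤-trans; ≤-reflexive; ≤-antisym; <-trans; <-irrefl; <⇒≤; <⇒≢; <⇒≱; ≮⇒≥; ≤∧≢⇒<; n≤1+n; m≤m+n; m≤n+m;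
         +-suc; +-comm; +-assoc; +-identityʳ; +-cancelʳ-≡; +-cancelʳ-≤; +-cancelˡ-≤; +-mono-≤; +-monoˡ-≤; +-monoʳ-≤;
         +-commutativeSemigroup; m∸n+n≡m; *-suc; *-distribˡ-+; *-cancelˡ-≤; *-monoˡ-≤; module ≤-Reasoning)
  renaming (_≟_ to _≟ℕ_; _<?_ to _<?ℕ_; <-cmp to <ℕ-cmp)
open import Data.Nat.Tactic.RingSolver using (solve-∀)
open import Algebra.Properties.CommutativeSemigroup +-commutativeSemigroup using (xy∙z≈xz∙y; x∙yz≈yx∙z; x∙yz≈xz∙y)
open import Data.Fin using (toℕ) renaming (zero to fzero; suc to fsuc)
open import Data.Fin.Properties using (_≟_; toℕ<n; toℕ-injective; any?; ¬∀⟶∃¬; injective⇒≤)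
open import Data.Integer.Properties using (pos-*; drop‿+≤+)
open import Data.Integer.Solver using (module +-*-Solver)
open import Data.List using (List; []; _∷_; _++_; map; length)
open import Data.List.Properties using (length-map; length-++)
open import Data.List.Relation.Unary.Any using (here; there; index)
open import Data.List.Membership.Propositional using (_∈_; _∉_)
open import Data.List.Membership.Propositional.Properties using (∈-map⁺; ∈-++⁺ˡ; ∈-++⁺ʳ)
open import Data.List.Membership.Setoid.Properties using (index-injective)
open import Data.List.Membership.DecPropositional using (_∈?_)
open import Data.List.Relation.Binary.Subset.Propositional using (_⊆_)
open import Data.Maybe using (Maybe; just; nothing)
open import Data.Maybe.Properties using (just-injective)
open import Data.Product using (_×_; _,_; proj₁; proj₂)
open import Data.Sum using (_⊎_; inj₁; inj₂)
open import Data.Empty using (⊥-elim)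
open import Function using (_∘_; id)
open import Function.Bundles using (mk↔ₛ′)
open import Function.Definitions using (Injective)
open import Relation.Nullary using (¬_; yes; no)
open import Relation.Nullary.Decidable using (_⊎-dec_)
open import Relation.Binary.Definitions using (tri<; tri≈; tri>)
open import Relation.Binary.PropositionalEquality using (_≡_; _≢_; refl; sym; trans; cong; cong₂; subst; subst₂; ≢-sym; setoid; module ≡-Reasoning)

-- Pigeonhole on finite sets, and triangular numbers.

fresh : ∀ {v} (xs : List (Fin v)) → length xs < v → ∃ λ y → y ∉ xs
fresh {v} xs short = ¬∀⟶∃¬ v (_∈ xs) (λ y → _∈?_ _≟_ y xs) λ all → <⇒≱ short (injective⇒≤ (index-inj all))
  where
  index-inj : (all : ∀ y → y ∈ xs) → Injective _≡_ _≡_ (λ y → index (all y))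
  index-inj all {x} {y} = index-injective (setoid (Fin v)) (all x) (all y)

-- A missed value `y` could be added as an extra image, giving an injection of `Fin (suc v)` into
-- `Fin v`.
injective⇒surjective : ∀ {v} (f : Fin v → Fin v) → Injective _≡_ _≡_ f → ∀ y → ∃ λ x → f x ≡ y
injective⇒surjective {v} f inj y with any? (λ x → f x ≟ y)
... | yes hit = hit
... | no miss = ⊥-elim (<-irrefl refl (injective⇒≤ {f = g} g-inj))
  where
  g : Fin (suc v) → Fin v
  g fzero    = y
  g (fsuc x) = f x
  g-inj : Injective _≡_ _≡_ g
  g-inj {fzero}  {fzero}  _ = refl
  g-inj {fzero}  {fsuc x} e = ⊥-elim (miss (x , sym e))
  g-inj {fsuc x} {fzero}  e = ⊥-elim (miss (x , e))
  g-inj {fsuc x} {fsuc z} e = cong fsuc (inj e)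

injective⇒↔ : ∀ {v} (f : Fin v → Fin v) → Injective _≡_ _≡_ f → Fin v ↔ Fin v
injective⇒↔ f inj = mk↔ₛ′ f (proj₁ ∘ sur) (proj₂ ∘ sur) (λ x → inj (proj₂ (sur (f x))))
  where sur = injective⇒surjective f inj

-- The binomial coefficient "m choose 2", the number of pairs among m entries; `tri n` is the M of
-- the overview.
tri : ℕ → ℕ
tri zero    = 0
tri (suc m) = m +ℕ tri m

tri-mono : ∀ {m n} → m ≤ℕ n → tri m ≤ℕ tri n
tri-mono z≤n       = z≤n
tri-mono (s≤s m≤n) = +-mono-≤ m≤n (tri-mono m≤n)

2*tri : ∀ m → 2 *ℕ tri (suc m) ≡ suc m *ℕ m
2*tri zero    = refl
2*tri (suc m) = begin
  2 *ℕ (suc m +ℕ tri (suc m))       ≡⟨ *-distribˡ-+ 2 (suc m) (tri (suc m)) ⟩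
  2 *ℕ suc m +ℕ 2 *ℕ tri (suc m)    ≡⟨ cong (2 *ℕ suc m +ℕ_) (2*tri m) ⟩
  2 *ℕ suc m +ℕ suc m *ℕ m          ≡⟨ expand m ⟩
  suc (suc m) *ℕ suc m              ∎
  where
  open ≡-Reasoning
  expand : ∀ m → 2 *ℕ suc m +ℕ suc m *ℕ m ≡ suc (suc m) *ℕ suc m
  expand = solve-∀

-- Partially filled sequences and their windows.

module _ {A : Set} where

  place : (ℕ → Maybe A) → ℕ → A → ℕ → Maybe A
  place f p y q with q ≟ℕ p
  ... | yes _ = just y
  ... | no  _ = f q

  place-here : ∀ f p y → place f p y p ≡ just y
  place-here f p y with p ≟ℕ p
  ... | yes _  = refl
  ... | no p≢p = ⊥-elim (p≢p refl)

  place-elsewhere : ∀ f {p} y {q} → q ≢ p → place f p y q ≡ f q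
  place-elsewhere f {p} y {q} q≢p with q ≟ℕ p
  ... | yes q≡p = ⊥-elim (q≢p q≡p)
  ... | no  _   = refl

  place-just : ∀ f p y q {a} → place f p y q ≡ just a → (q ≡ p × y ≡ a) ⊎ (q ≢ p × f q ≡ just a)
  place-just f p y q e with q ≟ℕ p
  ... | yes q≡p = inj₁ (q≡p , just-injective e)
  ... | no  q≢p = inj₂ (q≢p , e)

  prepend : Maybe A → List A → List A
  prepend nothing  xs = xs
  prepend (just x) xs = x ∷ xs

  -- The entries at the last `m` positions before `L`, cut off at position 0. Blanks are skipped, so
  -- the length counts occupied positions only.
  window : (ℕ → Maybe A) → ℕ → ℕ → List A
  window f zero    _       = []
  window f (suc L) zero    = []
  window f (suc L) (suc m) = prepend (f L) (window f L m)

  prepend-⊆ : ∀ x {xs} → xs ⊆ prepend x xs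
  prepend-⊆ nothing  a∈ = a∈
  prepend-⊆ (just x) a∈ = there a∈

  length-prepend : ∀ x xs → length (prepend x xs) ≤ℕ suc (length xs)
  length-prepend nothing  xs = n≤1+n _
  length-prepend (just x) xs = ≤-refl

  ∈-window : ∀ f L m {q a} → q < L → L ≤ℕ q +ℕ m → f q ≡ just a → a ∈ window f L m
  ∈-window f (suc L) zero {q} q<L L≤ _ = ⊥-elim (<⇒≱ q<L (subst (suc L ≤ℕ_) (+-identityʳ q) L≤))
  ∈-window f (suc L) (suc m) {q} (s≤s q≤L) L≤ e with q ≟ℕ L
  ... | yes refl rewrite e = here refl
  ... | no  q≢L = prepend-⊆ (f L) (∈-window f L m (≤∧≢⇒< q≤L q≢L) (s≤s⁻¹ (subst (suc L ≤ℕ_) (+-suc q m) L≤)) e)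

  length-window : ∀ f L m → length (window f L m) ≤ℕ m
  length-window f zero    m       = z≤n
  length-window f (suc L) zero    = z≤n
  length-window f (suc L) (suc m) = ≤-trans (length-prepend (f L) _) (s≤s (length-window f L m))

  -- A blank contributes no entry. This saves one entry per window and yields the factor n - 1 in
  -- the count of dangerous points.
  length-window-blank : ∀ f L m {q} → q < L → L ≤ℕ q +ℕ m → f q ≡ nothing → length (window f L m) < m
  length-window-blank f (suc L) zero {q} q<L L≤ _ = ⊥-elim (<⇒≱ q<L (subst (suc L ≤ℕ_) (+-identityʳ q) L≤))
  length-window-blank f (suc L) (suc m) {q} (s≤s q≤L) L≤ e with q ≟ℕ L
  ... | yes refl rewrite e = s≤s (length-window f L m)
  ... | no  q≢L = ≤-trans (s≤s (length-prepend (f L) _)) (s≤s (length-window-blank f L m (≤∧≢⇒< q≤L q≢L) (s≤s⁻¹ (subst (suc L ≤ℕ_) (+-suc q m) L≤)) e))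

∉-∷ : ∀ {A : Set} {x y : A} {xs} → x ≢ y → x ∉ xs → x ∉ y ∷ xs
∉-∷ x≢y x∉ (here x≡y) = x≢y x≡y
∉-∷ x≢y x∉ (there x∈) = x∉ x∈

-- Third points of pairs in the Steiner triple system.

module _ {v : ℕ} (S : STS v) where

  record Collinear (x y z : Fin v) : Set where
    constructor collinear
    field
      x≢y   : x ≢ y
      x≢z   : x ≢ z
      y≢z   : y ≢ z
      {t}   : Triple v
      t∈    : t ∈ blocks S
      x∈t   : x ∈ᵇ t
      y∈t   : y ∈ᵇ t
      z∈t   : z ∈ᵇ t

  collinear-swap : ∀ {x y z} → Collinear x y z → Collinear x z y
  collinear-swap (collinear a b c t d e f) = collinear b a (≢-sym c) t d f e

  collinear-rotate : ∀ {x y z} → Collinear x y z → Collinear z x y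
  collinear-rotate (collinear a b c t d e f) = collinear (≢-sym b) (≢-sym c) a t f d e

  remaining : Fin v → Fin v → Triple v → Fin v
  remaining x y (a , b , c) with (a ≟ x) ⊎-dec (a ≟ y) | (b ≟ x) ⊎-dec (b ≟ y)
  ... | no  _ | _     = a
  ... | yes _ | no  _ = b
  ... | yes _ | yes _ = c

  -- Three distinct points exhaust the three entries of `t`. Whenever two of them claim the same
  -- entry, or an entry contradicts the outcome of a test, the case is absurd.
  remaining-unique : ∀ {x y z} t → z ≢ x → z ≢ y → x ≢ y → z ∈ᵇ t → x ∈ᵇ t → y ∈ᵇ t → z ≡ remaining x y t
  remaining-unique {x} {y} (a , b , c) z≢x z≢y x≢y z∈ x∈ y∈
    with (a ≟ x) ⊎-dec (a ≟ y) | (b ≟ x) ⊎-dec (b ≟ y) | z∈ | x∈ | y∈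
  ... | no  _ | _     | inj₁ refl        | _ | _ = refl
  ... | no ¬a | _     | _ | inj₁ refl | _ = ⊥-elim (¬a (inj₁ refl))
  ... | no ¬a | _     | _ | _ | inj₁ refl = ⊥-elim (¬a (inj₂ refl))
  ... | no  _ | _     | inj₂ (inj₁ refl) | inj₂ (inj₁ refl) | _ = ⊥-elim (z≢x refl)
  ... | no  _ | _     | inj₂ (inj₁ refl) | _ | inj₂ (inj₁ refl) = ⊥-elim (z≢y refl)
  ... | no  _ | _     | inj₂ (inj₂ refl) | inj₂ (inj₂ refl) | _ = ⊥-elim (z≢x refl)
  ... | no  _ | _     | inj₂ (inj₂ refl) | _ | inj₂ (inj₂ refl) = ⊥-elim (z≢y refl)
  ... | no  _ | _     | _ | inj₂ (inj₁ refl) | inj₂ (inj₁ refl) = ⊥-elim (x≢y refl)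
  ... | no  _ | _     | _ | inj₂ (inj₂ refl) | inj₂ (inj₂ refl) = ⊥-elim (x≢y refl)
  ... | yes (inj₁ refl) | _ | inj₁ refl | _ | _ = ⊥-elim (z≢x refl)
  ... | yes (inj₂ refl) | _ | inj₁ refl | _ | _ = ⊥-elim (z≢y refl)
  ... | yes _ | no  _ | inj₂ (inj₁ refl) | _ | _ = refl
  ... | yes _ | no ¬b | _ | inj₂ (inj₁ refl) | _ = ⊥-elim (¬b (inj₁ refl))
  ... | yes _ | no ¬b | _ | _ | inj₂ (inj₁ refl) = ⊥-elim (¬b (inj₂ refl))
  ... | yes _ | no  _ | inj₂ (inj₂ refl) | inj₂ (inj₂ refl) | _ = ⊥-elim (z≢x refl)
  ... | yes _ | no  _ | inj₂ (inj₂ refl) | _ | inj₂ (inj₂ refl) = ⊥-elim (z≢y refl)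
  ... | yes _ | no  _ | _ | inj₁ refl | inj₁ refl = ⊥-elim (x≢y refl)
  ... | yes _ | yes (inj₁ refl) | inj₂ (inj₁ refl) | _ | _ = ⊥-elim (z≢x refl)
  ... | yes _ | yes (inj₂ refl) | inj₂ (inj₁ refl) | _ | _ = ⊥-elim (z≢y refl)
  ... | yes _ | yes _ | inj₂ (inj₂ refl) | _ | _ = refl

  -- The product of the Steiner quasigroup, with the idempotent convention on the diagonal.
  third : Fin v → Fin v → Fin v
  third x y with x ≟ y
  ... | yes _  = x
  ... | no x≢y = remaining x y (proj₁ (pair-cover S x y x≢y))

  -- Only one block passes through `x` and `y`, so the block witnessing collinearity is the one that
  -- `third` inspects.
  third-unique : ∀ {z x y} → Collinear z x y → z ≡ third x y
  third-unique {z} {x} {y} (collinear z≢x z≢y x≢y {t} t∈ z∈ x∈ y∈) with x ≟ y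
  ... | yes x≡y = ⊥-elim (x≢y x≡y)
  ... | no x≢y′ with pair-cover S x y x≢y′
  ...   | u , _ , unique with unique t t∈ x∈ y∈
  ...     | refl = remaining-unique u z≢x z≢y x≢y z∈ x∈ y∈

  -- Each unordered pair is listed once, which keeps the length at `tri` rather than twice that.
  thirds : List (Fin v) → List (Fin v)
  thirds []       = []
  thirds (x ∷ xs) = map (third x) xs ++ thirds xs

  length-thirds : ∀ xs → length (thirds xs) ≡ tri (length xs)
  length-thirds []       = refl
  length-thirds (x ∷ xs) = trans (length-++ (map (third x) xs)) (cong₂ _+ℕ_ (length-map (third x) xs) (length-thirds xs))

  ∈-map-third : ∀ {z x y xs} → y ∈ xs → Collinear z x y → z ∈ map (third x) xs
  ∈-map-third {x = x} {xs = xs} y∈ zxy = subst (_∈ map (third x) xs) (sym (third-unique zxy)) (∈-map⁺ (third x) y∈)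

  ∈-thirds : ∀ {z a b xs} → a ∈ xs → b ∈ xs → Collinear z a b → z ∈ thirds xs
  ∈-thirds (here refl) (here refl) zab = ⊥-elim (Collinear.y≢z zab refl)
  ∈-thirds (here refl) (there b∈)  zab = ∈-++⁺ˡ (∈-map-third b∈ zab)
  ∈-thirds (there a∈)  (here refl) zab = ∈-++⁺ˡ (∈-map-third a∈ (collinear-swap zab))
  ∈-thirds (there a∈)  (there b∈)  zab = ∈-++⁺ʳ _ (∈-thirds a∈ b∈ zab)

  -- Partial good sequencings, with k = ℓ - 2.

  module Construction (k : ℕ) where

    -- n = ℓ − 1 is the largest distance inside a window, and d = ℓ.
    n d : ℕ
    n = suc k
    d = suc n

    -- Distance at most `n`, written without subtraction. Three positions fit into ℓ consecutive
    -- ones exactly when they are pairwise close.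
    Close : ℕ → ℕ → Set
    Close p q = p ≤ℕ q +ℕ n × q ≤ℕ p +ℕ n

    record Partial : Set where
      field
        at        : ℕ → Maybe (Fin v)
        used      : List (Fin v)
        covered   : ∀ {q a} → at q ≡ just a → a ∈ used
        injective : ∀ {p q a} → at p ≡ just a → at q ≡ just a → p ≡ q
        avoids    : ∀ {p q r a b c} → p ≢ q → p ≢ r → q ≢ r → Close p q → Close p r → Close q r →
                    at p ≡ just a → at q ≡ just b → at r ≡ just c → ¬ Collinear a b c
    open Partial

    record Free (s : Partial) (p : ℕ) (y : Fin v) : Set where
      field
        unused     : y ∉ used s
        admissible : ∀ {q r a b} → q ≢ p → r ≢ p → Close p q → Close p r → Close q r →
                     at s q ≡ just a → at s r ≡ just b → ¬ Collinear y a b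
    open Free

    swap-close : ∀ {p q} → Close p q → Close q p
    swap-close (p≤ , q≤) = q≤ , p≤

    insert : ∀ s p y → Free s p y → Partial
    insert s p y free = record { at = at′ ; used = y ∷ used s ; covered = λ {q} → covered′ {q}
                           ; injective = λ {q} {r} → injective′ {q} {r} ; avoids = λ {q} {r} {u} → avoids′ {q} {r} {u} }
      where
      at′ = place (at s) p y
      covered′ : ∀ {q a} → at′ q ≡ just a → a ∈ y ∷ used s
      covered′ {q} e with place-just (at s) p y q e
      ... | inj₁ (_ , refl) = here refl
      ... | inj₂ (_ , e′)   = there (covered s e′)
      injective′ : ∀ {q r a} → at′ q ≡ just a → at′ r ≡ just a → q ≡ r
      injective′ {q} {r} e e′ with place-just (at s) p y q e | place-just (at s) p y r e′
      ... | inj₁ (refl , _)    | inj₁ (refl , _)    = refl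
      ... | inj₁ (_ , refl)    | inj₂ (_ , r↦)      = ⊥-elim (unused free (covered s r↦))
      ... | inj₂ (_ , q↦)      | inj₁ (_ , refl)    = ⊥-elim (unused free (covered s q↦))
      ... | inj₂ (_ , q↦)      | inj₂ (_ , r↦)      = injective s q↦ r↦
      avoids′ : ∀ {q r u a b c} → q ≢ r → q ≢ u → r ≢ u → Close q r → Close q u → Close r u →
                at′ q ≡ just a → at′ r ≡ just b → at′ u ≡ just c → ¬ Collinear a b c
      avoids′ {q} {r} {u} q≢r q≢u r≢u qr qu ru e e′ e″
        with place-just (at s) p y q e | place-just (at s) p y r e′ | place-just (at s) p y u e″
      ... | inj₂ (_ , q↦)      | inj₂ (_ , r↦)      | inj₂ (_ , u↦)      = avoids s q≢r q≢u r≢u qr qu ru q↦ r↦ u↦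
      -- `admissible` speaks of the new point in first place; in the next two cases rotations of the
      -- block bring it there.
      ... | inj₁ (refl , refl) | inj₂ (r≢p , r↦)    | inj₂ (u≢p , u↦)    = admissible free r≢p u≢p qr qu ru r↦ u↦
      ... | inj₂ (q≢p , q↦)    | inj₁ (refl , refl) | inj₂ (u≢p , u↦)    =
            admissible free u≢p q≢p ru (swap-close qr) (swap-close qu) u↦ q↦ ∘ collinear-rotate ∘ collinear-rotate
      ... | inj₂ (q≢p , q↦)    | inj₂ (r≢p , r↦)    | inj₁ (refl , refl) =
            admissible free q≢p r≢p (swap-close qu) (swap-close ru) qr q↦ r↦ ∘ collinear-rotate
      ... | inj₁ (refl , _)    | inj₁ (refl , _)    | _                  = ⊥-elim (q≢r refl)
      ... | inj₁ (refl , _)    | _                  | inj₁ (refl , _)    = ⊥-elim (q≢u refl)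
      ... | _                  | inj₁ (refl , _)    | inj₁ (refl , _)    = ⊥-elim (r≢u refl)

    -- Greedy extension to the right.

    Fresh : ℕ → Partial → Set
    Fresh L s = ∀ {q} → L ≤ℕ q → at s q ≡ nothing

    just-before : ∀ {L} s → Fresh L s → ∀ {q a} → at s q ≡ just a → q < L
    just-before {L} s fresh-L {q} e with q <?ℕ L
    ... | yes q<L = q<L
    ... | no  q≮L with trans (sym e) (fresh-L (≮⇒≥ q≮L))
    ...   | ()

    Filled : Partial → ℕ → Set
    Filled s q = ∃ λ a → at s q ≡ just a

    -- Since nothing lies at or beyond `L`, a block completed at `L` uses two of the `n` preceding
    -- entries. Their pairs exclude at most `tri n` points, on top of `used s` and the caller's own
    -- exclusions `E`.
    choose : ∀ s L E → Fresh L s → length (used s) +ℕ (length E +ℕ tri n) < v → ∃ λ y → y ∉ E × Free s L y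
    choose s L E fresh-L room with fresh (used s ++ E ++ thirds W) short
      where
      W = window (at s) L n
      short : length (used s ++ E ++ thirds W) < v
      short = begin-strict
        length (used s ++ E ++ thirds W)                     ≡⟨ length-++ (used s) ⟩
        length (used s) +ℕ length (E ++ thirds W)            ≡⟨ cong (length (used s) +ℕ_) (length-++ E) ⟩
        length (used s) +ℕ (length E +ℕ length (thirds W))   ≡⟨ cong (λ m → length (used s) +ℕ (length E +ℕ m)) (length-thirds W) ⟩
        length (used s) +ℕ (length E +ℕ tri (length W))      ≤⟨ +-monoʳ-≤ (length (used s)) (+-monoʳ-≤ (length E) (tri-mono (length-window (at s) L n))) ⟩
        length (used s) +ℕ (length E +ℕ tri n)               <⟨ room ⟩
        v                                                    ∎
        where open ≤-Reasoning
    ... | y , y∉ = y , y∉ ∘ ∈-++⁺ʳ (used s) ∘ ∈-++⁺ˡ , record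
      { unused     = y∉ ∘ ∈-++⁺ˡ
      ; admissible = λ _ _ Lq Lr _ q↦ r↦ yab → y∉ (∈-++⁺ʳ (used s) (∈-++⁺ʳ E (∈-thirds (in-window Lq q↦) (in-window Lr r↦) yab)))
      }
      where
      in-window : ∀ {q a} → Close L q → at s q ≡ just a → a ∈ window (at s) L n
      in-window (L≤ , _) q↦ = ∈-window (at s) L n (just-before s fresh-L q↦) L≤ q↦

    -- `count` says that points and positions grow by the same amount, one new point per position,
    -- with the subtractions cleared.
    record Extends (s : Partial) (L : ℕ) (s′ : Partial) (L′ : ℕ) : Set where
      field
        grows   : L ≤ℕ L′
        fresh′  : Fresh L′ s′
        agrees  : ∀ {q} → q < L → at s′ q ≡ at s q
        filled  : ∀ {q} → L ≤ℕ q → q < L′ → Filled s′ q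
        used-⊆  : used s ⊆ used s′
        count   : length (used s′) +ℕ L ≡ length (used s) +ℕ L′
    open Extends

    keep-filled : ∀ {s L s′ L′ q} → Extends s L s′ L′ → Filled s q → q < L → Filled s′ q
    keep-filled ext (a , q↦) q<L = a , trans (agrees ext q<L) q↦

    extends-refl : ∀ {s L} → Fresh L s → Extends s L s L
    extends-refl fresh-L = record
      { grows = ≤-refl ; fresh′ = fresh-L ; agrees = λ _ → refl ; used-⊆ = id ; count = refl
      ; filled = λ L≤q q<L → ⊥-elim (<⇒≱ q<L L≤q) }

    extends-trans : ∀ {s L s′ L′ s″ L″} → Extends s L s′ L′ → Extends s′ L′ s″ L″ → Extends s L s″ L″
    extends-trans {s} {L} {s′} {L′} {s″} {L″} e e′ = record
      { grows  = ≤-trans (grows e) (grows e′)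
      ; fresh′ = fresh′ e′
      ; agrees = λ q<L → trans (agrees e′ (≤-trans q<L (grows e))) (agrees e q<L)
      ; filled = filled″
      ; used-⊆ = used-⊆ e′ ∘ used-⊆ e
      ; count  = +-cancelʳ-≡ L′ _ _ (begin
          (length (used s″) +ℕ L) +ℕ L′  ≡⟨ xy∙z≈xz∙y (length (used s″)) L L′ ⟩
          (length (used s″) +ℕ L′) +ℕ L  ≡⟨ cong (_+ℕ L) (count e′) ⟩
          (length (used s′) +ℕ L″) +ℕ L  ≡⟨ xy∙z≈xz∙y (length (used s′)) L″ L ⟩
          (length (used s′) +ℕ L) +ℕ L″  ≡⟨ cong (_+ℕ L″) (count e) ⟩
          (length (used s) +ℕ L′) +ℕ L″  ≡⟨ xy∙z≈xz∙y (length (used s)) L′ L″ ⟩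
          (length (used s) +ℕ L″) +ℕ L′  ∎)
      }
      where
      open ≡-Reasoning
      filled″ : ∀ {q} → L ≤ℕ q → q < L″ → Filled s″ q
      filled″ {q} L≤q q<L″ with q <?ℕ L′
      ... | yes q<L′ = keep-filled e′ (filled e L≤q q<L′) q<L′
      ... | no  q≮L′ = filled e′ (≮⇒≥ q≮L′) q<L″

    extends-insert : ∀ {s L y} → Fresh L s → (free : Free s L y) → Extends s L (insert s L y free) (suc L)
    extends-insert {s} {L} {y} fresh-L free = record
      { grows  = n≤1+n L
      ; fresh′ = λ L<q → trans (place-elsewhere (at s) y (≢-sym (<⇒≢ L<q))) (fresh-L (<⇒≤ L<q))
      ; agrees = λ q<L → place-elsewhere (at s) y (<⇒≢ q<L)
      ; filled = λ { L≤q (s≤s q≤L) → subst (Filled (insert s L y free)) (≤-antisym L≤q q≤L) (y , place-here (at s) L y) }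
      ; used-⊆ = there
      ; count  = sym (+-suc (length (used s)) L)
      }

    -- By `count`, both sides of the inequality grow equally. It expresses that the positions before
    -- `L` outnumber the used points by at least `tri n`, the surplus being reserved as blanks.
    balance : ∀ {s L s′ L′} → Extends s L s′ L′ → length (used s) +ℕ tri n ≤ℕ L → length (used s′) +ℕ tri n ≤ℕ L′
    balance {s} {L} {s′} {L′} e bal = +-cancelʳ-≤ L _ _ (begin
      (length (used s′) +ℕ tri n) +ℕ L  ≡⟨ xy∙z≈xz∙y (length (used s′)) (tri n) L ⟩
      (length (used s′) +ℕ L) +ℕ tri n  ≡⟨ cong (_+ℕ tri n) (count e) ⟩
      (length (used s) +ℕ L′) +ℕ tri n  ≡⟨ xy∙z≈xz∙y (length (used s)) L′ (tri n) ⟩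
      (length (used s) +ℕ tri n) +ℕ L′  ≤⟨ +-monoˡ-≤ L′ bal ⟩
      L +ℕ L′                           ≡⟨ +-comm L L′ ⟩
      L′ +ℕ L                           ∎)
      where open ≤-Reasoning

    -- At a position below `v` the balance inequality leaves fewer than `v` excluded points, so the
    -- greedy choice cannot get stuck.
    greedy : ∀ j {s L} → Fresh L s → length (used s) +ℕ tri n ≤ℕ L → j +ℕ L ≤ℕ v → ∃ λ s′ → Extends s L s′ (j +ℕ L)
    greedy zero    fresh-L bal room = _ , extends-refl fresh-L
    greedy (suc j) fresh-L bal room with greedy j fresh-L bal (<⇒≤ room)
    ... | s′ , ext with choose s′ _ [] (fresh′ ext) (≤-trans (s≤s (balance ext bal)) room)
    ...   | y , _ , free = _ , extends-trans ext (extends-insert (fresh′ ext) free)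

    -- Absorbing the dangerous points.

    -- Once k = n − 1 fillers are placed from L on, any pair among the last n positions has its later member
    -- at or after L, so clearness from L on makes t admissible.
    Clear : Fin v → ℕ → Partial → Set
    Clear t L s = ∀ {q r a b} → q < r → L ≤ℕ r → r ≤ℕ q +ℕ n → at s q ≡ just a → at s r ≡ just b → ¬ Collinear t a b

    -- Each filler avoids `t` and the third points of `t` with the `n` preceding entries, so no pair
    -- ending in a filler forms a block with `t`. This costs up to `suc n` further exclusions in
    -- `choose`.
    pad : ∀ t j {s L} → Fresh L s → t ∉ used s → j +ℕ (length (used s) +ℕ (suc n +ℕ tri n)) ≤ℕ v →
          ∃ λ s′ → Extends s L s′ (j +ℕ L) × t ∉ used s′ × Clear t L s′
    pad t zero {s} fresh-L t∉ room =
      s , extends-refl fresh-L , t∉ , λ _ L≤r _ _ r↦ → ⊥-elim (<⇒≱ (just-before s fresh-L r↦) L≤r)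
    pad t (suc j) {s} {L} fresh-L t∉ room with pad t j fresh-L t∉ (<⇒≤ room)
    ... | s′ , ext , t∉′ , clear with choose s′ (j +ℕ L) (t ∷ map (third t) (window (at s′) (j +ℕ L) n)) (fresh′ ext) room′
      where
      W = window (at s′) (j +ℕ L) n
      used′ : length (used s′) ≡ j +ℕ length (used s)
      used′ = +-cancelʳ-≡ L _ _ (trans (count ext) (x∙yz≈yx∙z (length (used s)) j L))
      room′ : length (used s′) +ℕ (suc (length (map (third t) W)) +ℕ tri n) < v
      room′ = begin-strict
        length (used s′) +ℕ (suc (length (map (third t) W)) +ℕ tri n)  ≡⟨ cong (λ m → length (used s′) +ℕ (suc m +ℕ tri n)) (length-map (third t) W) ⟩
        length (used s′) +ℕ (suc (length W) +ℕ tri n)                  ≤⟨ +-monoʳ-≤ (length (used s′)) (+-monoˡ-≤ (tri n) (s≤s (length-window (at s′) (j +ℕ L) n))) ⟩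
        length (used s′) +ℕ (suc n +ℕ tri n)                           ≡⟨ cong (_+ℕ (suc n +ℕ tri n)) used′ ⟩
        (j +ℕ length (used s)) +ℕ (suc n +ℕ tri n)                     ≡⟨ +-assoc j _ _ ⟩
        j +ℕ (length (used s) +ℕ (suc n +ℕ tri n))                     <⟨ room ⟩
        v                                                              ∎
        where open ≤-Reasoning
    ...   | y , y∉ , free = _ , extends-trans ext (extends-insert (fresh′ ext) free) , ∉-∷ (λ t≡y → y∉ (here (sym t≡y))) t∉′ , clear′
      where
      clear′ : Clear t L (insert s′ (j +ℕ L) y free)
      clear′ {q} {r} q<r L≤r r≤ q↦ r↦ tab with place-just (at s′) _ y q q↦ | place-just (at s′) _ y r r↦
      ... | inj₁ (refl , _)  | inj₁ (refl , _)    = <-irrefl refl q<r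
      ... | inj₁ (refl , _)  | inj₂ (_ , r↦′)     = <⇒≱ (just-before s′ (fresh′ ext) r↦′) (<⇒≤ q<r)
      ... | inj₂ (_ , q↦′)   | inj₁ (refl , refl) = y∉ (there (∈-map-third (∈-window (at s′) _ n q<r r≤ q↦′) (collinear-rotate tab)))
      ... | inj₂ (_ , q↦′)   | inj₂ (_ , r↦′)     = clear q<r L≤r r≤ q↦′ r↦′ tab

    target : ∀ t {s L} → Fresh L s → t ∉ used s → k +ℕ (length (used s) +ℕ (suc n +ℕ tri n)) ≤ℕ v →
             ∃ λ s′ → Extends s L s′ (n +ℕ L) × t ∈ used s′
    target t {s} {L} fresh-L t∉ room with pad t k fresh-L t∉ room
    ... | s′ , ext , t∉′ , clear = insert s′ (k +ℕ L) t free , extends-trans ext (extends-insert (fresh′ ext) free) , here refl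
      where
      recent : ∀ {q r} → k +ℕ L ≤ℕ q +ℕ n → q < r → L ≤ℕ r
      -- Here q ≥ k + L - n = L - 1, so r ≥ L: this is why `k` fillers suffice.
      recent {q} {r} kL≤ q<r = ≤-trans (+-cancelˡ-≤ k _ _ (≤-trans kL≤ (≤-reflexive (trans (+-suc q k) (+-comm (suc q) k))))) q<r
      free : Free s′ (k +ℕ L) t
      free = record { unused = t∉′ ; admissible = λ {q} {r} → adm {q} {r} }
        where
        adm : ∀ {q r a b} → q ≢ k +ℕ L → r ≢ k +ℕ L → Close (k +ℕ L) q → Close (k +ℕ L) r → Close q r →
              at s′ q ≡ just a → at s′ r ≡ just b → ¬ Collinear t a b
        adm {q} {r} _ _ (Lq , _) (Lr , _) (q≤ , r≤) q↦ r↦ tab with <ℕ-cmp q r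
        ... | tri< q<r _ _  = clear q<r (recent Lq q<r) r≤ q↦ r↦ tab
        ... | tri> _ _ r<q  = clear r<q (recent Lr r<q) q≤ r↦ q↦ (collinear-swap tab)
        ... | tri≈ _ refl _ = Collinear.y≢z tab (just-injective (trans (sym q↦) r↦))

    -- A point costs `n` positions, `k` fillers and itself, or none if an earlier step already
    -- placed it. The slack `suc n` pays for the extra exclusions made by the fillers.
    absorb : ∀ ts {s L} → Fresh L s → length (used s) +ℕ tri n ≤ℕ L → length ts *ℕ n +ℕ L +ℕ suc n ≤ℕ v →
             ∃ λ s′ → ∃ λ L′ → Extends s L s′ L′ × ts ⊆ used s′ × L′ ≤ℕ v
    absorb [] fresh-L bal room = _ , _ , extends-refl fresh-L , (λ ()) , ≤-trans (m≤m+n _ _) room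
    absorb (t ∷ ts) {s} {L} fresh-L bal room with _∈?_ _≟_ t (used s)
    ... | yes t∈ with absorb ts fresh-L bal (≤-trans (+-monoˡ-≤ (suc n) (+-monoˡ-≤ L (m≤n+m (length ts *ℕ n) n))) room)
    ...   | s′ , L′ , ext , ts⊆ , L′≤v = s′ , L′ , ext , (λ { (here refl) → used-⊆ ext t∈ ; (there u∈) → ts⊆ u∈ }) , L′≤v
    absorb (t ∷ ts) {s} {L} fresh-L bal room | no t∉ with target t fresh-L t∉ room₁
      where
      room₁ : k +ℕ (length (used s) +ℕ (suc n +ℕ tri n)) ≤ℕ v
      room₁ = begin
        k +ℕ (length (used s) +ℕ (suc n +ℕ tri n))  ≡⟨ cong (k +ℕ_) (x∙yz≈xz∙y (length (used s)) (suc n) (tri n)) ⟩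
        k +ℕ (length (used s) +ℕ tri n +ℕ suc n)    ≤⟨ +-mono-≤ (≤-trans (n≤1+n k) (m≤m+n n _)) (+-monoˡ-≤ (suc n) bal) ⟩
        n +ℕ length ts *ℕ n +ℕ (L +ℕ suc n)         ≡⟨ sym (+-assoc (n +ℕ length ts *ℕ n) L (suc n)) ⟩
        n +ℕ length ts *ℕ n +ℕ L +ℕ suc n           ≤⟨ room ⟩
        v                                           ∎
        where open ≤-Reasoning
    ... | s₁ , ext₁ , t∈ with absorb ts (fresh′ ext₁) (balance ext₁ bal)
                               (≤-trans (≤-reflexive (cong (_+ℕ suc n) (x∙yz≈yx∙z (length ts *ℕ n) n L))) room)
    ...   | s′ , L′ , ext , ts⊆ , L′≤v =
            s′ , L′ , extends-trans ext₁ ext , (λ { (here refl) → used-⊆ ext t∈ ; (there u∈) → ts⊆ u∈ }) , L′≤v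

    -- The initial periods and their dangerous points.

    -- `T` lists the dangerous points: a point outside `T` forms no block with two entries at
    -- distance at most `n`.
    Captures : Partial → List (Fin v) → Set
    Captures s T = ∀ {q r a b z} → q < r → r ≤ℕ q +ℕ n → at s q ≡ just a → at s r ≡ just b → Collinear z a b → z ∈ T

    -- Each position filled here has the blank `b` among its `n` predecessors, so it sees at most
    -- `k` entries and creates at most `k` new dangerous points.
    after-blank : ∀ j → j ≤ℕ n → ∀ {s b T} → Fresh b s → Captures s T → j +ℕ length (used s) +ℕ tri n ≤ℕ v →
                  ∃ λ s′ → ∃ λ T′ → Extends s (suc b) s′ (j +ℕ suc b) × Captures s′ T′ × length T′ ≤ℕ j *ℕ k +ℕ length T
    -- Extending from `suc b` rather than from `b` is what keeps `b` blank.
    after-blank zero _ fresh-b captures room = _ , _ , extends-refl (fresh-b ∘ <⇒≤) , captures , ≤-refl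
    after-blank (suc j) (s≤s j≤k) {s} {b} {T} fresh-b captures room
      with after-blank j (≤-trans j≤k (n≤1+n k)) fresh-b captures (<⇒≤ room)
    ... | s′ , T′ , ext , captures′ , short with choose s′ (j +ℕ suc b) [] (fresh′ ext) room′
      where
      room′ : length (used s′) +ℕ tri n < v
      room′ = subst (λ m → m +ℕ tri n < v)
        (sym (+-cancelʳ-≡ (suc b) _ _ (trans (count ext) (x∙yz≈yx∙z (length (used s)) j (suc b))))) room
    ...   | y , _ , free = _ , map (third y) W ++ T′ , extends-trans ext (extends-insert (fresh′ ext) free) , captures″ , short″
      where
      W = window (at s′) (j +ℕ suc b) n
      W-short : length W ≤ℕ k
      W-short = s≤s⁻¹ (length-window-blank (at s′) (j +ℕ suc b) n (m≤n+m (suc b) j)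
        (≤-trans (≤-reflexive (trans (+-suc j b) (+-comm (suc j) b))) (+-monoʳ-≤ b (s≤s j≤k)))
        (trans (agrees ext ≤-refl) (fresh-b ≤-refl)))
      short″ : length (map (third y) W ++ T′) ≤ℕ suc j *ℕ k +ℕ length T
      short″ = begin
        length (map (third y) W ++ T′)         ≡⟨ length-++ (map (third y) W) ⟩
        length (map (third y) W) +ℕ length T′  ≡⟨ cong (_+ℕ length T′) (length-map (third y) W) ⟩
        length W +ℕ length T′                  ≤⟨ +-mono-≤ W-short short ⟩
        k +ℕ (j *ℕ k +ℕ length T)              ≡⟨ sym (+-assoc k _ _) ⟩
        suc j *ℕ k +ℕ length T                 ∎
        where open ≤-Reasoning
      captures″ : Captures (insert s′ (j +ℕ suc b) y free) (map (third y) W ++ T′)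
      captures″ {q} {r} q<r r≤ q↦ r↦ zab with place-just (at s′) _ y q q↦ | place-just (at s′) _ y r r↦
      ... | inj₁ (refl , _)  | inj₁ (refl , _)    = ⊥-elim (<-irrefl refl q<r)
      ... | inj₁ (refl , _)  | inj₂ (_ , r↦′)     = ⊥-elim (<⇒≱ (just-before s′ (fresh′ ext) r↦′) (<⇒≤ q<r))
      ... | inj₂ (_ , q↦′)   | inj₁ (refl , refl) = ∈-++⁺ˡ (∈-map-third (∈-window (at s′) _ n q<r r≤ q↦′) (collinear-swap zab))
      ... | inj₂ (_ , q↦′)   | inj₂ (_ , r↦′)     = ∈-++⁺ʳ _ (captures′ q<r r≤ q↦′ r↦′ zab)

    Blank : ℕ → ℕ → Set
    Blank i q = ∃ λ m → m < i × q ≡ m *ℕ d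

    -- A period is one blank followed by `n` greedy entries; it adds `n` used points and at most
    -- `n * k` dangerous ones.
    fill-periods : ∀ i → i *ℕ n +ℕ tri n ≤ℕ v →
                   ∃ λ s → ∃ λ T → Fresh (i *ℕ d) s × length (used s) ≡ i *ℕ n × Captures s T × length T ≤ℕ i *ℕ (n *ℕ k) ×
                                   (∀ {q} → q < i *ℕ d → Filled s q ⊎ Blank i q)
    fill-periods zero room = empty , [] , (λ _ → refl) , refl , (λ { _ _ () }) , z≤n , λ ()
      where
      empty : Partial
      empty = record { at = λ _ → nothing ; used = [] ; covered = λ () ; injective = λ () ; avoids = λ { _ _ _ _ _ _ () } }
    fill-periods (suc i) room with fill-periods i (≤-trans (+-monoˡ-≤ (tri n) (m≤n+m (i *ℕ n) n)) room)
    ... | s , T , fresh-s , used≡ , captures , short , filled-s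
      with after-blank n ≤-refl {s} {i *ℕ d} fresh-s captures (subst (λ m → n +ℕ m +ℕ tri n ≤ℕ v) (sym used≡) room)
    ...   | s′ , T′ , ext , captures′ , short′ =
            s′ , T′ , (λ {q} → fresh′ ext ∘ subst (_≤ℕ q) (sym end)) , used≡′ , captures′ ,
            ≤-trans short′ (+-monoʳ-≤ (n *ℕ k) short) , filled′
      where
      b = i *ℕ d
      end : n +ℕ suc b ≡ suc i *ℕ d
      end = +-suc n b
      used≡′ : length (used s′) ≡ suc i *ℕ n
      used≡′ = trans (+-cancelʳ-≡ (suc b) _ _ (trans (count ext) (x∙yz≈yx∙z (length (used s)) n (suc b)))) (cong (n +ℕ_) used≡)
      filled′ : ∀ {q} → q < suc i *ℕ d → Filled s′ q ⊎ Blank (suc i) q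
      filled′ {q} q< with <ℕ-cmp q b
      ... | tri≈ _ q≡b _ = inj₂ (i , ≤-refl , q≡b)
      ... | tri> _ _ b<q = inj₁ (filled ext b<q (subst (q <_) (sym end) q<))
      ... | tri< q<b _ _ with filled-s q<b
      ...   | inj₁ f               = inj₁ (keep-filled ext f (≤-trans q<b (n≤1+n b)))
      ...   | inj₂ (m , m<i , q≡)  = inj₂ (m , ≤-trans m<i (n≤1+n i) , q≡)

    -- Filling the blanks.

    blank-gap : ∀ {i m} → i < m → ¬ m *ℕ d ≤ℕ i *ℕ d +ℕ n
    blank-gap {i} i<m = <⇒≱ (≤-trans (≤-reflexive (cong suc (+-comm (i *ℕ d) n))) (*-monoˡ-≤ d i<m))

    -- Distinct multiples of `d`, which is n + 1, differ by more than `n`.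
    blanks-apart : ∀ i m → Close (i *ℕ d) (m *ℕ d) → i ≡ m
    blanks-apart i m (i≤ , m≤) with <ℕ-cmp i m
    ... | tri≈ _ i≡m _ = i≡m
    ... | tri< i<m _ _ = ⊥-elim (blank-gap i<m m≤)
    ... | tri> _ _ m<i = ⊥-elim (blank-gap m<i i≤)

    fill-blanks : ∀ {s M} i → i ≤ℕ M → M +ℕ length (used s) ≤ℕ v →
      (∀ {q r a b z} → q < r → r ≤ℕ q +ℕ n → r < M *ℕ d → at s q ≡ just a → at s r ≡ just b → Collinear z a b → z ∈ used s) →
      ∃ λ s′ → length (used s′) ≡ i +ℕ length (used s) × used s ⊆ used s′ × (∀ {q} → ¬ Blank M q → at s′ q ≡ at s q) ×
               (∀ {q} → Filled s q → Filled s′ q) × (∀ {q} → Blank i q → Filled s′ q)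
    fill-blanks {s} zero _ _ _ = s , refl , id , (λ _ → refl) , id , λ { (_ , () , _) }
    fill-blanks {s} {M} (suc i) i<M room absorbed with fill-blanks {s} {M} i (<⇒≤ i<M) room absorbed
    ... | s₁ , used≡ , used⊆ , agree , keep , blanks with fresh (used s₁) (subst (_< v) (sym used≡) (≤-trans (+-monoˡ-≤ _ i<M) room))
    ...   | y , y∉ = insert s₁ p y free , cong suc used≡ , there ∘ used⊆ , agree′ , keep₁ ∘ keep , blanks′
      where
      p = i *ℕ d
      near : ∀ {q} → Close p q → q < M *ℕ d
      -- From `i < M`: a blank and its `n` successors stay inside the first `M` periods.
      near (_ , q≤) = ≤-trans (s≤s q≤) (≤-trans (≤-reflexive (cong suc (+-comm p n))) (*-monoˡ-≤ d i<M))
      not-blank : ∀ {q} → q ≢ p → Close p q → ¬ Blank M q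
      not-blank q≢p pq (m , _ , refl) = q≢p (cong (_*ℕ d) (sym (blanks-apart i m pq)))
      old : ∀ {u c} → u ≢ p → Close p u → at s₁ u ≡ just c → at s u ≡ just c
      old u≢p pu = trans (sym (agree (not-blank u≢p pu)))
      free : Free s₁ p y
      free = record { unused = y∉ ; admissible = λ {q} {r} → adm {q} {r} }
        where
        adm : ∀ {q r a b} → q ≢ p → r ≢ p → Close p q → Close p r → Close q r →
              at s₁ q ≡ just a → at s₁ r ≡ just b → ¬ Collinear y a b
        adm {q} {r} q≢p r≢p pq pr (q≤ , r≤) q↦ r↦ yab with <ℕ-cmp q r
        ... | tri≈ _ refl _ = Collinear.y≢z yab (just-injective (trans (sym q↦) r↦))
        ... | tri< q<r _ _ = y∉ (used⊆ (absorbed q<r r≤ (near pr) (old q≢p pq q↦) (old r≢p pr r↦) yab))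
        ... | tri> _ _ r<q = y∉ (used⊆ (absorbed r<q q≤ (near pq) (old r≢p pr r↦) (old q≢p pq q↦) (collinear-swap yab)))
      s₂ = insert s₁ p y free
      agree′ : ∀ {q} → ¬ Blank M q → at s₂ q ≡ at s q
      agree′ ¬blank = trans (place-elsewhere (at s₁) y (λ q≡p → ¬blank (i , i<M , q≡p))) (agree ¬blank)
      keep₁ : ∀ {q} → Filled s₁ q → Filled s₂ q
      keep₁ {q} (a , q↦) with q ≟ℕ p
      ... | yes _ = y , refl
      ... | no  _ = a , q↦
      blanks′ : ∀ {q} → Blank (suc i) q → Filled s₂ q
      blanks′ {q} (m , s≤s m≤i , q≡) with m ≟ℕ i
      ... | yes refl = subst (Filled s₂) (sym q≡) (y , place-here (at s₁) p y)
      ... | no  m≢i  = keep₁ (blanks (m , ≤∧≢⇒< m≤i m≢i , q≡))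

    -- Assembling the sequencing.

    periods-balanced : ∀ M → M *ℕ n +ℕ M ≡ M *ℕ d
    periods-balanced M = trans (+-comm (M *ℕ n) M) (sym (*-suc M n))

    complete : let M = tri n in M *ℕ (n *ℕ k) *ℕ n +ℕ M *ℕ d +ℕ d ≤ℕ v → ∃ λ s → ∀ {q} → q < v → Filled s q
    complete room
      with fill-periods (tri n) (≤-trans (≤-reflexive (periods-balanced (tri n))) (≤-trans (m≤n+m (tri n *ℕ d) _) (≤-trans (m≤m+n _ d) room)))
    ... | s₁ , T , fresh₁ , used≡ , captures , short , filled₁
      -- The choice of `tri n` periods reserves exactly `tri n` blanks, so the balance inequality
      -- starts as an equality.
      with ≤-reflexive (trans (cong (_+ℕ tri n) used≡) (periods-balanced (tri n)))
    ... | balanced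
      with absorb T fresh₁ balanced (≤-trans (+-monoˡ-≤ d (+-monoˡ-≤ (tri n *ℕ d) (*-monoˡ-≤ n short))) room)
    ... | s₂ , L , ext₂ , T⊆ , L≤v
      with greedy (v ∸ L) (fresh′ ext₂) (balance ext₂ balanced) (≤-reflexive (m∸n+n≡m L≤v))
    ... | s₃ , ext₃ = s₄ , filled₄
      where
      M = tri n
      ext : Extends s₁ (M *ℕ d) s₃ v
      ext = subst (Extends s₁ (M *ℕ d) s₃) (m∸n+n≡m L≤v) (extends-trans ext₂ ext₃)
      absorbed : ∀ {q r a b z} → q < r → r ≤ℕ q +ℕ n → r < M *ℕ d → at s₃ q ≡ just a → at s₃ r ≡ just b → Collinear z a b → z ∈ used s₃
      -- The later stages leave the positions below `M * d` untouched, so the dangerous points of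
      -- `s₁` are those of `s₃` there, and all have been placed.
      absorbed q<r r≤ r< q↦ r↦ zab = used-⊆ ext₃ (T⊆ (captures q<r r≤
        (trans (sym (agrees ext (<-trans q<r r<))) q↦) (trans (sym (agrees ext r<)) r↦) zab))
      -- Balance at position `v` guarantees at least `M` unplaced points, enough for the `M` blanks.
      patched = fill-blanks {s₃} M ≤-refl (≤-trans (≤-reflexive (+-comm M _)) (balance ext balanced)) absorbed
      s₄ = proj₁ patched
      keep : ∀ {q} → Filled s₃ q → Filled s₄ q
      keep = proj₁ (proj₂ (proj₂ (proj₂ (proj₂ patched))))
      blanks : ∀ {q} → Blank M q → Filled s₄ q
      blanks = proj₂ (proj₂ (proj₂ (proj₂ (proj₂ patched))))
      filled₄ : ∀ {q} → q < v → Filled s₄ q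
      filled₄ {q} q<v with q <?ℕ M *ℕ d
      ... | no  q≮ = keep (filled ext (≮⇒≥ q≮) q<v)
      ... | yes q< with filled₁ q<
      ...   | inj₁ f     = keep (keep-filled ext f q<)
      ...   | inj₂ blank = blanks blank


    -- An injective filling of `v` positions by `v` points is a permutation. Positions in one window
    -- are pairwise close, so `avoids` rules out a block among them.
    sequencing : ∀ s → (∀ {q} → q < v → Filled s q) → ∃ λ σ → GoodSequencing d S σ
    sequencing s full = injective⇒↔ σ σ-inj , good
      where
      σ : Fin v → Fin v
      σ i = proj₁ (full (toℕ<n i))
      at-σ : ∀ i → at s (toℕ i) ≡ just (σ i)
      at-σ i = proj₂ (full (toℕ<n i))
      σ-inj : Injective _≡_ _≡_ σ
      σ-inj {i} {j} e = toℕ-injective (injective s (at-σ i) (trans (at-σ j) (cong just (sym e))))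
      close : ∀ {j p q} → j ≤ℕ p → p < j +ℕ d → j ≤ℕ q → q < j +ℕ d → Close p q
      close {j} j≤p p< j≤q q< = half p< j≤q , half q< j≤p
        where
        half : ∀ {p q} → p < j +ℕ d → j ≤ℕ q → p ≤ℕ q +ℕ n
        half p< j≤q = s≤s⁻¹ (≤-trans p< (≤-trans (≤-reflexive (+-suc j n)) (s≤s (+-monoˡ-≤ n j≤q))))
      good : GoodSequencing d S (injective⇒↔ σ σ-inj)
      good j _ t@(a , b , c) t∈ contained
        with contained a (inj₁ refl) | contained b (inj₂ (inj₁ refl)) | contained c (inj₂ (inj₂ refl)) | blocks-3 S t∈
      ... | p , (j≤p , p<) , refl | q , (j≤q , q<) , refl | r , (j≤r , r<) , refl | a<b , b<c =
        avoids s (apart a≢b) (apart a≢c) (apart b≢c) (close j≤p p< j≤q q<) (close j≤p p< j≤r r<) (close j≤q q< j≤r r<)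
          (at-σ p) (at-σ q) (at-σ r)
          (collinear a≢b a≢c b≢c t∈ (inj₁ refl) (inj₂ (inj₁ refl)) (inj₂ (inj₂ refl)))
        where
        <⇒distinct : ∀ {x y : Fin v} → toℕ x < toℕ y → x ≢ y
        <⇒distinct x<y refl = <-irrefl refl x<y
        apart : ∀ {i i′} → σ i ≢ σ i′ → toℕ i ≢ toℕ i′
        apart σi≢ e = σi≢ (cong σ (toℕ-injective e))
        a≢b = <⇒distinct a<b
        b≢c = <⇒distinct b<c
        a≢c = <⇒distinct (<-trans a<b b<c)

-- Arithmetic of the bound.

bound : ℤ → ℤ
bound ℓ = (ℓ - + 1) * (ℓ ^ 5 - + 9 * ℓ ^ 3 + + 20 * ℓ ^ 2 - + 36 * ℓ + + 16)

-- The bound in Horner form, in terms of m = ℓ − 3.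
boundℕ : ℕ → ℕ
boundℕ m = 176 +ℕ m *ℕ (580 +ℕ m *ℕ (664 +ℕ m *ℕ (371 +ℕ m *ℕ (111 +ℕ m *ℕ (17 +ℕ m *ℕ 1)))))

horner-step : ∀ c m {y z} → + y ≡ z → + (c +ℕ m *ℕ y) ≡ + c + + m * z
horner-step c m {y} y≡z = cong (λ i → + c + i) (trans (pos-* m y) (cong (λ i → + m * i) y≡z))

-- Substituting ℓ = m + 3 makes all coefficients positive, which moves the bound from the integers
-- to the naturals.
bound-pos : ∀ m → bound (+ (3 +ℕ m)) ≡ + boundℕ m
bound-pos m = trans (expand (+ m)) (sym (horner-step 176 m (horner-step 580 m (horner-step 664 m (horner-step 371 m (horner-step 111 m (horner-step 17 m refl)))))))
  where
  open +-*-Solver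
  expand : ∀ x → bound (+ 3 + x) ≡ + 176 + x * (+ 580 + x * (+ 664 + x * (+ 371 + x * (+ 111 + x * (+ 17 + x * + 1)))))
  expand = solve 1 (λ x → let ℓ = con (+ 3) :+ x in
    (ℓ :- con (+ 1)) :* (ℓ :^ 5 :- con (+ 9) :* ℓ :^ 3 :+ con (+ 20) :* ℓ :^ 2 :- con (+ 36) :* ℓ :+ con (+ 16))
    := con (+ 176) :+ x :* (con (+ 580) :+ x :* (con (+ 664) :+ x :* (con (+ 371) :+ x :* (con (+ 111) :+ x :* (con (+ 17) :+ x :* con (+ 1))))))) refl

-- Multiplying by 16 lets `2*tri` replace `2 * M` by `n * k`; what remains is a comparison of
-- polynomials in `m`.
enough-room : ∀ m {v} → bound (+ (3 +ℕ m)) ≤ + 16 * + v →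
  let k = suc m; n = suc k; d = suc n; M = tri n in M *ℕ (n *ℕ k) *ℕ n +ℕ M *ℕ d +ℕ d ≤ℕ v
enough-room m {v} hyp = *-cancelˡ-≤ 16 (begin
  16 *ℕ (M *ℕ (n *ℕ k) *ℕ n +ℕ M *ℕ d +ℕ d)                ≡⟨ double M (n *ℕ k) n d ⟩
  8 *ℕ (2 *ℕ M *ℕ (n *ℕ k) *ℕ n +ℕ 2 *ℕ M *ℕ d +ℕ 2 *ℕ d)  ≡⟨ cong (λ P → 8 *ℕ (P *ℕ (n *ℕ k) *ℕ n +ℕ P *ℕ d +ℕ 2 *ℕ d)) (2*tri k) ⟩
  -- The summand added here is the second polynomial in `expand`. Its coefficients are natural
  -- numbers, so the bound dominates the required room.
  8 *ℕ (n *ℕ k *ℕ (n *ℕ k) *ℕ n +ℕ n *ℕ k *ℕ d +ℕ 2 *ℕ d)  ≤⟨ m≤m+n _ _ ⟩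
  _                                                        ≡⟨ expand m ⟩
  boundℕ m                                                 ≤⟨ drop‿+≤+ (subst₂ _≤_ (bound-pos m) (sym (pos-* 16 v)) hyp) ⟩
  16 *ℕ v                                                  ∎)
  where
  open ≤-Reasoning
  k = suc m
  n = suc k
  d = suc n
  M = tri n
  double : ∀ M a n d → 16 *ℕ (M *ℕ a *ℕ n +ℕ M *ℕ d +ℕ d) ≡ 8 *ℕ (2 *ℕ M *ℕ a *ℕ n +ℕ 2 *ℕ M *ℕ d +ℕ 2 *ℕ d)
  double = solve-∀
  expand : ∀ m → 8 *ℕ ((2 +ℕ m) *ℕ (1 +ℕ m) *ℕ ((2 +ℕ m) *ℕ (1 +ℕ m)) *ℕ (2 +ℕ m) +ℕ (2 +ℕ m) *ℕ (1 +ℕ m) *ℕ (3 +ℕ m) +ℕ 2 *ℕ (3 +ℕ m)) +ℕ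
      (16 +ℕ m *ℕ (252 +ℕ m *ℕ (312 +ℕ m *ℕ (163 +ℕ m *ℕ (47 +ℕ m *ℕ (9 +ℕ m *ℕ 1))))))
    ≡ 176 +ℕ m *ℕ (580 +ℕ m *ℕ (664 +ℕ m *ℕ (371 +ℕ m *ℕ (111 +ℕ m *ℕ (17 +ℕ m *ℕ 1)))))
  expand = solve-∀

theorem3p6 : (ℓ : ℕ) → ℓ ≥ 3 → (v : ℕ) → (S : STS v) →
    (+ ℓ - + 1) * ((+ ℓ) ^ 5 - + 9 * (+ ℓ) ^ 3 + + 20 * (+ ℓ) ^ 2 - + 36 * + ℓ + + 16) ≤ + 16 * + v →
    ∃ λ (σ : Fin v ↔ Fin v) → GoodSequencing ℓ S σ
-- With ℓ = m + 3 the parameter k = ℓ - 2 is `suc m`.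
theorem3p6 (suc (suc (suc m))) (s≤s (s≤s (s≤s _))) v S hyp =
  let s , full = Construction.complete S (suc m) (enough-room m hyp) in Construction.sequencing S (suc m) s full
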